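{- Let $b,m>1$ be integers with $\gcd(b,m)=1$, and let $\frac{1}{m}=(0.\,a_1a_2\cdots a_i\cdots)_b$ be the base-$b$ expansion of $\frac1m$ (so $\frac1m=\sum_{i\ge1}a_ib^{ -i}$ with digits $a_i\in\{0,\dots,b-1\}$). Then for every positive integer $t$, the base-$(b+mt)$ expansion of $\frac1m$ is \[ \tfrac{1}{m}=(0.\,a'_1a'_2\cdots a'_i\cdots)_{b+mt}, \] where for each $i\ge1$, $a'_i=a_i+t\,k_i$ with $k_i=(b^{i-1}\bmod m)$.
   Context: For integers $x$ and $m>0$, $x \bmod m$ denotes the least nonnegative residue of $x$ modulo $m$. The notation $(0.\,c_1c_2\cdots)_B$ denotes the number $\sum_{i\ge1}c_iB^{ -i}$ with digits $c_i\in\{0,\dots,B-1\}$. -}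

module Defs where

open import Data.Integer.Base using (+_)
open import Data.Nat.Base as ℕ using (ℕ; zero; suc; 2+; NonZero; NonTrivial)
open import Data.Nat.Properties using (m^n≢0)
open import Data.Product.Base using (_×_; ∃-syntax)
open import Data.Rational.Base using (ℚ; 0ℚ; _/_; _+_; _-_; ∣_∣; _<_)

instance
  base-nonZero : ∀ {n} → .{{NonTrivial n}} → NonZero n
  base-nonZero {n} = ℕ.nonTrivial⇒nonZero n

+-nonTrivial : ∀ m n → .{{NonTrivial m}} → NonTrivial (m ℕ.+ n)
+-nonTrivial (2+ _) _ = _

ConvergesTo : (ℕ → ℚ) → ℚ → Set
ConvergesTo s x =
  ∀ ε → 0ℚ < ε → ∃[ N ] (∀ n → N ℕ.≤ n → ∣ s n - x ∣ < ε)

-- Digit sequences are indexed from 1; the value c 0 is never used.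

partialSum : (B : ℕ) → .{{NonTrivial B}} → (ℕ → ℕ) → ℕ → ℚ
partialSum B c zero    = 0ℚ
partialSum B c (suc n) =
  partialSum B c n + (+ c (suc n) / B ℕ.^ suc n) {{m^n≢0 B (suc n)}}

-- x = (0. c₁c₂⋯)_B.  A sequence of rationals converges to a rational in ℝ
-- iff it does so with rational ε, so ℝ is not needed for rational x.

IsExpansion : (B : ℕ) → .{{NonTrivial B}} → ℚ → (ℕ → ℕ) → Set
IsExpansion B x c =
  (∀ i → 1 ℕ.≤ i → c i ℕ.< B) × ConvergesTo (partialSum B c) x

{-# OPTIONS --safe #-}

-- Let A n be the integer with base-b digits a₁⋯aₙ, so that A n / bⁿ is the nth
-- partial sum.  As m ∤ bⁿ, the bounds A n / bⁿ ≤ 1/m ≤ (A n + 1) / bⁿ force A n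
-- and kₙ₊₁ = bⁿ mod m to be quotient and remainder of bⁿ by m.  Comparing
-- consecutive n gives the long division step b kᵢ = m aᵢ + kᵢ₊₁.  Adding m t kᵢ to
-- both sides turns it into (b + m t) kᵢ = m a'ᵢ + kᵢ₊₁, long division of 1 by m in
-- base b + m t with the same remainders.

module Submission where

open import Defs
open import Data.Integer.Base as ℤ using (+_; +[1+_]; +≤+; +<+)
import Data.Integer.Properties as ℤ
open import Data.Nat.Base as ℕ
  using (ℕ; zero; suc; NonZero; NonTrivial; _+_; _*_; _^_; _∸_; _%_; _≤_; _<_)
open import Data.Nat.Coprimality as Coprimality
  using (Coprime; coprime-divisor; gcd≡1⇒coprime)
open import Data.Nat.Divisibility using (_∣_; divides; ∣1⇒≡1)
open import Data.Nat.DivMod using (m%n<n; [m+kn]%n≡m%n; m<n⇒m%n≡m)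
open import Data.Nat.GCD using (gcd)
open import Data.Nat.Properties
open import Data.Nat.Tactic.RingSolver using (solve-∀)
open import Data.Product.Base using (_,_)
open import Data.Rational.Base as ℚ using (ℚ; mkℚ; _/_; 0ℚ)
import Data.Rational.Properties as ℚ
open import Data.Rational.Solver using (module +-*-Solver)
import Data.Rational.Unnormalised.Base as ℚᵘ
import Data.Rational.Unnormalised.Properties as ℚᵘ
open import Function.Base using (it)
open import Relation.Binary.PropositionalEquality
open import Relation.Nullary using (¬_)

-- Order and sums of fractions of naturals in ℚ.

toℚᵘ-/ : ∀ i n .{{_ : NonZero n}} → ℚ.toℚᵘ (i / n) ℚᵘ.≃ i ℚᵘ./ n
toℚᵘ-/ i (suc n) = ℚ.toℚᵘ-fromℚᵘ (ℚᵘ.mkℚᵘ i n)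

/-mono-≤ : ∀ a m c n .{{_ : NonZero m}} .{{_ : NonZero n}} →
           a * n ≤ c * m → + a / m ℚ.≤ + c / n
/-mono-≤ a m@(suc _) c n@(suc _) an≤cm = ℚ.toℚᵘ-cancel-≤ (begin
  ℚ.toℚᵘ (+ a / m)  ≃⟨ toℚᵘ-/ (+ a) m ⟩
  + a ℚᵘ./ m        ≤⟨ ℚᵘ.*≤* (subst₂ ℤ._≤_ (ℤ.pos-* a n) (ℤ.pos-* c m) (+≤+ an≤cm)) ⟩
  + c ℚᵘ./ n        ≃⟨ toℚᵘ-/ (+ c) n ⟨
  ℚ.toℚᵘ (+ c / n)  ∎)
  where open ℚᵘ.≤-Reasoning

/-cancel-≤ : ∀ a m c n .{{_ : NonZero m}} .{{_ : NonZero n}} →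
             + a / m ℚ.≤ + c / n → a * n ≤ c * m
/-cancel-≤ a m@(suc _) c n@(suc _) a/m≤c/n =
  ℤ.drop‿+≤+ (subst₂ ℤ._≤_ (sym (ℤ.pos-* a n)) (sym (ℤ.pos-* c m)) (ℚᵘ.drop-*≤* (begin
    + a ℚᵘ./ m        ≃⟨ toℚᵘ-/ (+ a) m ⟨
    ℚ.toℚᵘ (+ a / m)  ≤⟨ ℚ.toℚᵘ-mono-≤ a/m≤c/n ⟩
    ℚ.toℚᵘ (+ c / n)  ≃⟨ toℚᵘ-/ (+ c) n ⟩
    + c ℚᵘ./ n        ∎)))
  where open ℚᵘ.≤-Reasoning

/-≡ : ∀ a m c n .{{_ : NonZero m}} .{{_ : NonZero n}} →
      a * n ≡ c * m → + a / m ≡ + c / n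
/-≡ a m c n eq = ℚ.≤-antisym (/-mono-≤ a m c n (≤-reflexive eq))
                             (/-mono-≤ c n a m (≤-reflexive (sym eq)))

/-+ : ∀ a m c n .{{_ : NonZero m}} .{{_ : NonZero n}} .{{_ : NonZero (m * n)}} →
      + a / m ℚ.+ + c / n ≡ + (a * n + c * m) / (m * n)
/-+ a m@(suc _) c n@(suc _) = ℚ.toℚᵘ-injective (begin-equality
  ℚ.toℚᵘ (+ a / m ℚ.+ + c / n)             ≃⟨ ℚ.toℚᵘ-homo-+ (+ a / m) (+ c / n) ⟩
  ℚ.toℚᵘ (+ a / m) ℚᵘ.+ ℚ.toℚᵘ (+ c / n)   ≃⟨ ℚᵘ.+-cong (toℚᵘ-/ (+ a) m) (toℚᵘ-/ (+ c) n) ⟩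
  + a ℚᵘ./ m ℚᵘ.+ + c ℚᵘ./ n               ≃⟨ ℚᵘ.≃-reflexive (cong (λ i → ℚᵘ.mkℚᵘ i _) numerator) ⟩
  ℚᵘ.mkℚᵘ (+ (a * n + c * m)) _            ≃⟨ toℚᵘ-/ (+ (a * n + c * m)) (m * n) {{m*n≢0 m n}} ⟨
  _                                        ∎)
  where
  open ℚᵘ.≤-Reasoning
  numerator : + a ℤ.* + n ℤ.+ + c ℤ.* + m ≡ + (a * n + c * m)
  numerator = sym (cong₂ ℤ._+_ (ℤ.pos-* a n) (ℤ.pos-* c m))

-- Divide `m * a + r ≡ p` by `m * p`. The remainder thus measures exactly how far `a / p` falls
-- short of `1 / m`.
1/m≡a/p+r/mp : ∀ m a r p .{{_ : NonZero m}} .{{_ : NonZero p}} .{{_ : NonZero (m * p)}} →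
               m * a + r ≡ p → + 1 / m ≡ + a / p ℚ.+ + r / (m * p)
1/m≡a/p+r/mp m a r p division =
  let instance
        pmp≢0 : NonZero (p * (m * p))
        pmp≢0 = m*n≢0 p (m * p)
  in trans
    (/-≡ 1 m (a * (m * p) + r * p) (p * (m * p)) (begin
      1 * (p * (m * p))          ≡⟨ *-identityˡ _ ⟩
      p * (m * p)                ≡⟨ cong (p *_) (*-comm m p) ⟩
      p * (p * m)                ≡⟨ cong (_* (p * m)) division ⟨
      (m * a + r) * (p * m)      ≡⟨ expand a p m r ⟩
      (a * (m * p) + r * p) * m  ∎))
    (sym (/-+ a p r (m * p)))
  where
  open ≡-Reasoning
  expand : ∀ a p m r → (m * a + r) * (p * m) ≡ (a * (m * p) + r * p) * m
  expand = solve-∀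

/<-ε : ∀ a m ε .{{_ : NonZero m}} → 0ℚ ℚ.< ε → a * ℚ.↧ₙ ε < m → + a / m ℚ.< ε
/<-ε a m@(suc _) ε@(mkℚ +[1+ p ] q _) 0<ε aq<m = ℚ.toℚᵘ-cancel-< (begin-strict
  ℚ.toℚᵘ (+ a / m)  ≃⟨ toℚᵘ-/ (+ a) m ⟩
  -- The numerator `suc p` of `ε` is at least 1, so `ε` is at least the reciprocal of its
  -- denominator, and `a / m` is below that reciprocal.
  + a ℚᵘ./ m        <⟨ ℚᵘ.*<* (subst₂ ℤ._<_ (ℤ.pos-* a (suc q)) (ℤ.pos-* (suc p) m)
                         (+<+ (<-≤-trans aq<m (m≤m+n m (p * m))))) ⟩
  ℚ.toℚᵘ ε          ∎)
  where open ℚᵘ.≤-Reasoning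
/<-ε a m (mkℚ (+ 0) _ _) (ℚ.*<* (+<+ ()))
/<-ε a m (mkℚ ℤ.-[1+ _ ] _ _) (ℚ.*<* ())

p<q⇒0<q-p : ∀ {p q} → p ℚ.< q → 0ℚ ℚ.< q ℚ.- p
p<q⇒0<q-p {p} {q} p<q = subst (ℚ._< q ℚ.- p) (ℚ.+-inverseʳ p) (ℚ.+-monoˡ-< (ℚ.- p) p<q)

p-q≡-[q-p] : ∀ p q → p ℚ.- q ≡ ℚ.- (q ℚ.- p)
p-q≡-[q-p] = solve 2 (λ p q → p :- q := :- (q :- p)) refl
  where open +-*-Solver

∣p-q∣≡∣q-p∣ : ∀ p q → ℚ.∣ p ℚ.- q ∣ ≡ ℚ.∣ q ℚ.- p ∣
∣p-q∣≡∣q-p∣ p q = trans (cong ℚ.∣_∣ (p-q≡-[q-p] p q)) (ℚ.∣-p∣≡∣p∣ (q ℚ.- p))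

p≤∣p∣ : ∀ p → p ℚ.≤ ℚ.∣ p ∣
p≤∣p∣ (mkℚ (+ _) _ _) = ℚ.≤-refl
p≤∣p∣ p@(mkℚ ℤ.-[1+ _ ] _ _) = ℚ.≤-trans (ℚ.<⇒≤ (ℚ.negative⁻¹ p)) (ℚ.0≤∣p∣ p)

p+q-p≡q : ∀ p q → p ℚ.+ q ℚ.- p ≡ q
p+q-p≡q = solve 2 (λ p q → p :+ q :- p := q) refl
  where open +-*-Solver

∣a/p-1/m∣<ε : ∀ m a r p .{{_ : NonZero m}} .{{_ : NonZero p}} → m * a + r ≡ p →
              ∀ ε → 0ℚ ℚ.< ε → r * ℚ.↧ₙ ε < m * p → ℚ.∣ + a / p ℚ.- + 1 / m ∣ ℚ.< ε
∣a/p-1/m∣<ε m a r p division ε 0<ε small =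
  let instance
        mp≢0 : NonZero (m * p)
        mp≢0 = m*n≢0 m p
  in begin-strict
    ℚ.∣ + a / p ℚ.- + 1 / m ∣
      ≡⟨ ∣p-q∣≡∣q-p∣ (+ a / p) (+ 1 / m) ⟩
    ℚ.∣ + 1 / m ℚ.- + a / p ∣
      ≡⟨ cong (λ x → ℚ.∣ x ℚ.- + a / p ∣) (1/m≡a/p+r/mp m a r p division) ⟩
    ℚ.∣ + a / p ℚ.+ + r / (m * p) ℚ.- + a / p ∣
      ≡⟨ cong ℚ.∣_∣ (p+q-p≡q (+ a / p) (+ r / (m * p))) ⟩
    ℚ.∣ + r / (m * p) ∣
      ≡⟨ ℚ.0≤p⇒∣p∣≡p (/-mono-≤ 0 1 r (m * p) {{ℕ.nonZero}} ℕ.z≤n) ⟩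
    + r / (m * p)
      <⟨ /<-ε r (m * p) ε 0<ε small ⟩
    ε ∎
  where open ℚ.≤-Reasoning

-- Passing eventual bounds to the limit.

module _ {s : ℕ → ℚ} {x : ℚ} (s→x : ConvergesTo s x) {p : ℚ} (k : ℕ) where

  -- If `x` were below `p`, then with `ε` the gap `p - x` a term late enough for both the bound and
  -- the convergence would lie at distance at least `ε` from `x`, yet closer than `ε`.
  limit-lower : (∀ n → k ≤ n → p ℚ.≤ s n) → p ℚ.≤ x
  limit-lower p≤s = ℚ.≮⇒≥ λ x<p →
    let N , close = s→x (p ℚ.- x) (p<q⇒0<q-p x<p)
        n = k ℕ.⊔ N
    in ℚ.<-irrefl refl (ℚ.<-≤-trans (close n (m≤n⊔m k N)) (begin
      p ℚ.- x           ≤⟨ ℚ.+-monoˡ-≤ (ℚ.- x) (p≤s n (m≤m⊔n k N)) ⟩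
      s n ℚ.- x         ≤⟨ p≤∣p∣ _ ⟩
      ℚ.∣ s n ℚ.- x ∣   ∎))
    where open ℚ.≤-Reasoning

  limit-upper : (∀ n → k ≤ n → s n ℚ.≤ p) → x ℚ.≤ p
  limit-upper s≤p = ℚ.≮⇒≥ λ p<x →
    let N , close = s→x (x ℚ.- p) (p<q⇒0<q-p p<x)
        n = k ℕ.⊔ N
    in ℚ.<-irrefl refl (ℚ.<-≤-trans (close n (m≤n⊔m k N)) (begin
      x ℚ.- p           ≤⟨ ℚ.+-monoʳ-≤ x (ℚ.neg-antimono-≤ (s≤p n (m≤m⊔n k N))) ⟩
      x ℚ.- s n         ≤⟨ p≤∣p∣ _ ⟩
      ℚ.∣ x ℚ.- s n ∣   ≡⟨ ∣p-q∣≡∣q-p∣ x (s n) ⟩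
      ℚ.∣ s n ℚ.- x ∣   ∎))
    where open ℚ.≤-Reasoning

-- Digit prefixes as integers, and the partial sums they represent.

digitsValue : ℕ → (ℕ → ℕ) → ℕ → ℕ
digitsValue B c zero    = 0
digitsValue B c (suc n) = B * digitsValue B c n + c (suc n)

n<B^n : ∀ B n → .{{NonTrivial B}} → n < B ^ n
n<B^n B zero    = ≤-refl
n<B^n B (suc n) = ≤-<-trans (n<B^n B n) (^-monoʳ-< B (ℕ.nonTrivial⇒n>1 B) (n<1+n n))

module _ (B : ℕ) .{{_ : NonTrivial B}} (c : ℕ → ℕ) where

  private
    A : ℕ → ℕ
    A = digitsValue B c

    -- Instance search on B ^ n commits to base-nonZero and fails, so the proofs of
    -- NonZero (B ^ n) are passed by hand.
    _/B^_ : ℕ → ℕ → ℚ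
    a /B^ n = (+ a / B ^ n) {{m^n≢0 B n}}

  partialSum≡digitsValue/B^n : ∀ n → partialSum B c n ≡ A n /B^ n
  partialSum≡digitsValue/B^n zero    = refl
  partialSum≡digitsValue/B^n (suc n) = begin
    partialSum B c n ℚ.+ c (suc n) /B^ (suc n)
      ≡⟨ cong (ℚ._+ c (suc n) /B^ (suc n)) (partialSum≡digitsValue/B^n n) ⟩
    A n /B^ n ℚ.+ c (suc n) /B^ (suc n)
      ≡⟨ /-+ (A n) (B ^ n) (c (suc n)) (B ^ suc n) {{m^n≢0 B n}} {{m^n≢0 B (suc n)}} {{denom≢0}} ⟩
    (+ (A n * B ^ suc n + c (suc n) * B ^ n) / (B ^ n * B ^ suc n)) {{denom≢0}}
      ≡⟨ /-≡ (A n * B ^ suc n + c (suc n) * B ^ n) (B ^ n * B ^ suc n) (A (suc n)) (B ^ suc n)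
           {{denom≢0}} {{m^n≢0 B (suc n)}} (cross (A n) (B ^ n) B (c (suc n))) ⟩
    A (suc n) /B^ (suc n)  ∎
    where
    open ≡-Reasoning
    denom≢0 : NonZero (B ^ n * B ^ suc n)
    denom≢0 = m*n≢0 (B ^ n) (B ^ suc n) {{m^n≢0 B n}} {{m^n≢0 B (suc n)}}
    cross : ∀ A P B c → (A * (B * P) + c * P) * (B * P) ≡ (B * A + c) * (P * (B * P))
    cross = solve-∀

  digitsValue-lower : ∀ n j → A n * B ^ j ≤ A (j + n)
  digitsValue-lower n zero    = ≤-reflexive (*-identityʳ (A n))
  digitsValue-lower n (suc j) = begin
    A n * (B * B ^ j)                    ≡⟨ swap (A n) B (B ^ j) ⟩
    B * (A n * B ^ j)                    ≤⟨ *-monoʳ-≤ B (digitsValue-lower n j) ⟩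
    B * A (j + n)                        ≤⟨ m≤m+n _ _ ⟩
    B * A (j + n) + c (suc (j + n))      ∎
    where
    open ≤-Reasoning
    swap : ∀ x y z → x * (y * z) ≡ y * (x * z)
    swap = solve-∀

  -- The `j` appended digits form a number below `B ^ j`. Keeping `suc` on both sides lets the
  -- induction close: a digit is at most `B - 1`, so its successor fits into one more multiple of
  -- `B`.
  digitsValue-upper : (∀ i → 1 ≤ i → c i < B) → ∀ n j → suc (A (j + n)) ≤ suc (A n) * B ^ j
  digitsValue-upper c<B n zero    = ≤-reflexive (sym (*-identityʳ (suc (A n))))
  digitsValue-upper c<B n (suc j) = begin
    suc (B * A (j + n) + c (suc (j + n)))  ≡⟨ +-suc _ _ ⟨
    B * A (j + n) + suc (c (suc (j + n)))  ≤⟨ +-monoʳ-≤ (B * A (j + n)) (c<B _ (ℕ.s≤s ℕ.z≤n)) ⟩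
    B * A (j + n) + B                      ≡⟨ +-comm _ B ⟩
    B + B * A (j + n)                      ≡⟨ *-suc B _ ⟨
    B * suc (A (j + n))                    ≤⟨ *-monoʳ-≤ B (digitsValue-upper c<B n j) ⟩
    B * (suc (A n) * B ^ j)                ≡⟨ swap B (suc (A n)) (B ^ j) ⟩
    suc (A n) * (B * B ^ j)                ∎
    where
    open ≤-Reasoning
    swap : ∀ x y z → x * (y * z) ≡ y * (x * z)
    swap = solve-∀

  partialSum-lower : ∀ n k → n ≤ k → A n /B^ n ℚ.≤ partialSum B c k
  partialSum-lower n k n≤k =
    subst (λ i → A n /B^ n ℚ.≤ partialSum B c i) (m∸n+n≡m n≤k)
    (subst (A n /B^ n ℚ.≤_) (sym (partialSum≡digitsValue/B^n (j + n)))
    (/-mono-≤ (A n) (B ^ n) (A (j + n)) (B ^ (j + n)) {{m^n≢0 B n}} {{m^n≢0 B (j + n)}} (begin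
      A n * B ^ (j + n)      ≡⟨ cong (A n *_) (^-distribˡ-+-* B j n) ⟩
      A n * (B ^ j * B ^ n)  ≡⟨ *-assoc (A n) (B ^ j) (B ^ n) ⟨
      A n * B ^ j * B ^ n    ≤⟨ *-monoˡ-≤ (B ^ n) (digitsValue-lower n j) ⟩
      A (j + n) * B ^ n      ∎)))
    where
    open ≤-Reasoning
    j = k ∸ n

  -- Together with `partialSum-lower`, this traps all later partial sums, hence their limit, in an
  -- interval of length `1 / B ^ n`. The bound is not strict, since every later digit may be
  -- `B - 1`.
  partialSum-upper : (∀ i → 1 ≤ i → c i < B) →
                     ∀ n k → n ≤ k → partialSum B c k ℚ.≤ suc (A n) /B^ n
  partialSum-upper c<B n k n≤k =
    subst (λ i → partialSum B c i ℚ.≤ suc (A n) /B^ n) (m∸n+n≡m n≤k)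
    (subst (ℚ._≤ suc (A n) /B^ n) (sym (partialSum≡digitsValue/B^n (j + n)))
    (/-mono-≤ (A (j + n)) (B ^ (j + n)) (suc (A n)) (B ^ n) {{m^n≢0 B (j + n)}} {{m^n≢0 B n}} (begin
      A (j + n) * B ^ n            ≤⟨ *-monoˡ-≤ (B ^ n) (n≤1+n (A (j + n))) ⟩
      suc (A (j + n)) * B ^ n      ≤⟨ *-monoˡ-≤ (B ^ n) (digitsValue-upper c<B n j) ⟩
      suc (A n) * B ^ j * B ^ n    ≡⟨ *-assoc (suc (A n)) (B ^ j) (B ^ n) ⟩
      suc (A n) * (B ^ j * B ^ n)  ≡⟨ cong (suc (A n) *_) (^-distribˡ-+-* B j n) ⟨
      suc (A n) * B ^ (j + n)      ∎)))
    where
    open ≤-Reasoning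
    j = k ∸ n

  module _ (m : ℕ) .{{_ : NonZero m}} where

    expansion⇒lower : ConvergesTo (partialSum B c) (+ 1 / m) → ∀ n → m * A n ≤ B ^ n
    expansion⇒lower s→1/m n = subst₂ _≤_ (*-comm (A n) m) (*-identityˡ (B ^ n))
      (/-cancel-≤ (A n) (B ^ n) 1 m {{m^n≢0 B n}}
        (limit-lower s→1/m {A n /B^ n} n (partialSum-lower n)))

    expansion⇒upper : IsExpansion B (+ 1 / m) c → ∀ n → B ^ n ≤ m * suc (A n)
    expansion⇒upper (c<B , s→1/m) n = subst₂ _≤_ (*-identityˡ (B ^ n)) (*-comm (suc (A n)) m)
      (/-cancel-≤ 1 m (suc (A n)) (B ^ n) {{it}} {{m^n≢0 B n}}
        (limit-upper s→1/m {suc (A n) /B^ n} n (partialSum-upper c<B n)))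

    -- The error of the nth partial sum is `r n / (m * B ^ n)`, which is below `1 / B ^ n`. Since
    -- `n < B ^ n`, the denominator of `ε` serves as the threshold.
    remainders⇒converges : (r : ℕ → ℕ) → (∀ n → r n < m) →
                           (∀ n → m * A n + r n ≡ B ^ n) →
                           ConvergesTo (partialSum B c) (+ 1 / m)
    remainders⇒converges r r<m division ε 0<ε = ℚ.↧ₙ ε , λ n q≤n →
      subst (λ s → ℚ.∣ s ℚ.- + 1 / m ∣ ℚ.< ε) (sym (partialSum≡digitsValue/B^n n))
        (∣a/p-1/m∣<ε m (A n) (r n) (B ^ n) {{it}} {{m^n≢0 B n}} (division n) ε 0<ε
          (*-mono-< (r<m n) (≤-<-trans q≤n (n<B^n B n))))

-- Long division read off from an expansion.

coprime⇒∤^ : ∀ {m b} .{{_ : NonTrivial m}} → Coprime m b → ∀ n → ¬ m ∣ b ^ n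
coprime⇒∤^ {m} _ zero    m∣1 = ℕ.nonTrivial⇒≢1 (∣1⇒≡1 m∣1)
-- Coprimality strips one factor `b` at a time, until `m` would divide 1.
coprime⇒∤^ m⊥b   (suc n) m∣b^ = coprime⇒∤^ m⊥b n (coprime-divisor m⊥b m∣b^)

quotient⇒remainder : ∀ m q x .{{_ : NonZero m}} → m * q ≤ x → x < m * suc q → m * q + x % m ≡ x
quotient⇒remainder m q x mq≤x x<m[1+q] = begin
  m * q + x % m                    ≡⟨ cong (λ y → m * q + y % m) x≡ ⟩
  m * q + (x ∸ m * q + q * m) % m  ≡⟨ cong (λ y → m * q + y) ([m+kn]%n≡m%n (x ∸ m * q) q m) ⟩
  m * q + (x ∸ m * q) % m          ≡⟨ cong (λ y → m * q + y) (m<n⇒m%n≡m r<m) ⟩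
  m * q + (x ∸ m * q)              ≡⟨ m+[n∸m]≡n mq≤x ⟩
  x                                ∎
  where
  open ≡-Reasoning
  x≡ : x ≡ x ∸ m * q + q * m
  x≡ = sym (trans (cong (λ y → x ∸ m * q + y) (*-comm q m)) (m∸n+n≡m mq≤x))
  r<m : x ∸ m * q < m
  r<m = +-cancelʳ-< (m * q) _ _ (subst₂ _<_ (sym (m∸n+n≡m mq≤x)) (*-suc m q) x<m[1+q])

expansion⇒remainder : ∀ b m .{{_ : NonTrivial b}} .{{_ : NonTrivial m}} → gcd b m ≡ 1 →
                      ∀ a → IsExpansion b (+ 1 / m) a →
                      ∀ n → m * digitsValue b a n + b ^ n % m ≡ b ^ n
expansion⇒remainder b m gcd≡1 a expansion@(_ , s→1/m) n =
  quotient⇒remainder m A (b ^ n) (expansion⇒lower b a m s→1/m n)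
    -- Equality in the upper bound would make `b ^ n` the multiple `m * suc A`; coprimality rules
    -- this out, so the remainder is smaller than `m`.
    (≤∧≢⇒< (expansion⇒upper b a m expansion n) λ b^n≡ →
      coprime⇒∤^ (Coprimality.sym (gcd≡1⇒coprime gcd≡1)) n
        (divides (suc A) (trans b^n≡ (*-comm m (suc A)))))
  where A = digitsValue b a n

theorem1 : (b m : ℕ) .{{_ : NonTrivial b}} .{{_ : NonTrivial m}} →
    gcd b m ≡ 1 →
    (a : ℕ → ℕ) → IsExpansion b (+ 1 / m) a →
    (t : ℕ) .{{_ : NonZero t}} →
    (a' : ℕ → ℕ) →
    (∀ i → 1 ≤ i → a' i ≡ a i + t * (b ^ (i ∸ 1) % m)) →
    IsExpansion (b + m * t) {{+-nonTrivial b (m * t)}} (+ 1 / m) a'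
theorem1 b m gcd≡1 a expansion t a' a'≡ =
  a'<B , remainders⇒converges B {{+-nonTrivial b (m * t)}} a' m r r<m division'
  where
  open ≡-Reasoning
  B = b + m * t
  A = digitsValue b a
  A' = digitsValue B a'

  r : ℕ → ℕ
  r n = b ^ n % m

  r<m : ∀ n → r n < m
  r<m n = m%n<n (b ^ n) m

  division : ∀ n → m * A n + r n ≡ b ^ n
  division = expansion⇒remainder b m gcd≡1 a expansion

  step : ∀ n → m * a (suc n) + r (suc n) ≡ b * r n
  -- Subtract `b` times the division of `b ^ n` from the division of `b ^ suc n`; the shared term
  -- `b * (m * A n)` cancels.
  step n = +-cancelˡ-≡ (b * (m * A n)) _ _ (begin
    b * (m * A n) + (m * a (suc n) + r (suc n))  ≡⟨ regroup b m (A n) (a (suc n)) (r (suc n)) ⟩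
    m * A (suc n) + r (suc n)                    ≡⟨ division (suc n) ⟩
    b * b ^ n                                    ≡⟨ cong (b *_) (division n) ⟨
    b * (m * A n + r n)                          ≡⟨ *-distribˡ-+ b (m * A n) (r n) ⟩
    b * (m * A n) + b * r n                      ∎)
    where
    regroup : ∀ b m A d s → b * (m * A) + (m * d + s) ≡ m * (b * A + d) + s
    regroup = solve-∀

  step' : ∀ n → m * a' (suc n) + r (suc n) ≡ B * r n
  step' n = begin
    m * a' (suc n) + r (suc n)
      ≡⟨ cong (λ d → m * d + r (suc n)) (a'≡ (suc n) (ℕ.s≤s ℕ.z≤n)) ⟩
    m * (a (suc n) + t * r n) + r (suc n)
      ≡⟨ regroup m (a (suc n)) t (r n) (r (suc n)) ⟩
    (m * a (suc n) + r (suc n)) + m * t * r n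
      ≡⟨ cong (_+ m * t * r n) (step n) ⟩
    b * r n + m * t * r n
      ≡⟨ *-distribʳ-+ (r n) b (m * t) ⟨
    B * r n ∎
    where
    regroup : ∀ m d t k s → m * (d + t * k) + s ≡ (m * d + s) + m * t * k
    regroup = solve-∀

  -- The single steps `step'` are summed back up by induction, reversing the passage from `division`
  -- to `step`.
  division' : ∀ n → m * A' n + r n ≡ B ^ n
  -- The first remainder `r 0` is `1 % m`, which equals 1 because `m` exceeds 1.
  division' zero    = trans (cong (_+ r 0) (*-zeroʳ m)) (m<n⇒m%n≡m (ℕ.nonTrivial⇒n>1 m))
  division' (suc n) = begin
    m * (B * A' n + a' (suc n)) + r (suc n)       ≡⟨ regroup m B (A' n) (a' (suc n)) (r (suc n)) ⟩
    B * (m * A' n) + (m * a' (suc n) + r (suc n)) ≡⟨ cong (λ y → B * (m * A' n) + y) (step' n) ⟩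
    B * (m * A' n) + B * r n                      ≡⟨ *-distribˡ-+ B (m * A' n) (r n) ⟨
    B * (m * A' n + r n)                          ≡⟨ cong (B *_) (division' n) ⟩
    B * B ^ n                                     ∎
    where
    regroup : ∀ m B A d s → m * (B * A + d) + s ≡ B * (m * A) + (m * d + s)
    regroup = solve-∀

  B≢0 : NonZero B
  B≢0 = base-nonZero {{+-nonTrivial b (m * t)}}

  a'<B : ∀ i → 1 ≤ i → a' i < B
  -- By `step'`, `m * a' (suc n)` is at most `B * r n`, which is less than `B * m` because
  -- `r n < m`; cancel `m`.
  a'<B (suc n) _ = *-cancelˡ-< m _ _ (≤-<-trans
    (m≤m+n (m * a' (suc n)) (r (suc n)))
    (subst₂ _<_ (sym (step' n)) (*-comm B m) (*-monoʳ-< B {{B≢0}} (r<m n))))
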